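{- Let $\tau$ be a functional signature and let $\mathfrak{A},\mathfrak{B}$ be finitely generated $\tau$-algebras. Then $\mathfrak{B}$ is contained in the pseudovariety generated by $\mathfrak{A}$ if and only if the natural mapping from $\operatorname{Clo}(\mathfrak{A})$ onto $\operatorname{Clo}(\mathfrak{B})$ is well-defined and uniformly continuous with respect to pointwise convergence (i.e. with respect to the uniformities of pointwise convergence on $\operatorname{Clo}(\mathfrak{A})$ and $\operatorname{Clo}(\mathfrak{B})$).
   Context: Algebras are nonempty; $A$ denotes the domain of $\mathfrak{A}$. The pseudovariety generated by $\mathfrak{A}$ is the smallest class of $\tau$-algebras containing $\mathfrak{A}$ and closed under finite products, subalgebras, and homomorphic images (including isomorphic copies). For $k\ge1$, $T_k$ is the set of abstract $\tau$-terms over the variables $x_1,\dots,x_k$, and for $t\in T_k$, $t^{\mathfrak{A}}\colon A^k\to A$ is the induced term operation. $\operatorname{Clo}(\mathfrak{A})=\{t^{\mathfrak{A}}\mid t\in T_k,\ k\ge 1\}$ is the term clone, with $k$-ary part $\operatorname{Clo}(\mathfrak{A})_k=\{t^{\mathfrak{A}}\mid t\in T_k\}$. The natural mapping $\operatorname{Clo}(\mathfrak{A})\to\operatorname{Clo}(\mathfrak{B})$ is $t^{\mathfrak{A}}\mapsto t^{\mathfrak{B}}$ ($t\in T_k$, $k\ge1$); it is well-defined if $s^{\mathfrak{A}}=t^{\mathfrak{A}}$ implies $s^{\mathfrak{B}}=t^{\mathfrak{B}}$ for all $k\ge1$ and $s,t\in T_k$. The uniformity of pointwise convergence on $\operatorname{Clo}(\mathfrak{A})$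 is, for each $k\ge1$, the filter on $\operatorname{Clo}(\mathfrak{A})_k\times\operatorname{Clo}(\mathfrak{A})_k$ generated by the sets $\{(f,g)\mid f(\overline{a})=g(\overline{a})\}$, $\overline{a}\in A^k$. An arity-preserving map between clones is uniformly continuous if for every $k\ge1$ its restriction to $k$-ary elements is uniformly continuous (preimages of entourages are entourages). -}

module Defs where

open import Level using (Level; suc)
open import Data.Nat using (ℕ; NonZero)
open import Data.Fin using (Fin)
open import Data.List using (List)
open import Data.List.Relation.Unary.All using (All)
open import Data.Product using (Σ; ∃; _×_; _,_; proj₁; proj₂)
open import Data.Vec.Functional using (Vector)
open import Function.Bundles using (Func)
open import Function.Definitions using (Congruent; Surjective)
open import Relation.Binary.Bundles using (Setoid)
open import Relation.Binary.Core using (Rel)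
open import Relation.Binary.Definitions using (_Respects₂_)
open import Relation.Unary using (Pred; _∈_)

record Signature (ℓ : Level) : Set (suc ℓ) where
  field
    Op : Set ℓ
    ar : Op → ℕ

open Signature public

-- Domains are setoids, so that homomorphic images include quotients.
-- Nonemptiness is (constructively) given by an element; it is not a
-- constant of the signature, and homomorphisms need not preserve it.

record Algebra {ℓ} (τ : Signature ℓ) : Set (suc ℓ) where
  field
    domain   : Setoid ℓ ℓ
  open Setoid domain public
  field
    op       : (f : Op τ) → Vector Carrier (ar τ f) → Carrier
    op-cong  : ∀ f {x y : Vector Carrier (ar τ f)} →
               (∀ i → x i ≈ y i) → op f x ≈ op f y
    nonempty : Carrier

module _ {ℓ} {τ : Signature ℓ} where

  open Algebra using (Carrier; op)

  ∏ : ∀ {n} → (Fin n → Algebra τ) → Algebra τ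
  ∏ {n} C = record
    { domain   = record
      { Carrier       = Carrierᵖ
      ; _≈_           = λ x y → ∀ i → Algebra._≈_ (C i) (x i) (y i)
      ; isEquivalence = record
        { refl  = λ i → Algebra.refl (C i)
        ; sym   = λ p i → Algebra.sym (C i) (p i)
        ; trans = λ p q i → Algebra.trans (C i) (p i) (q i)
        }
      }
    ; op       = λ f x i → op (C i) f (λ j → x j i)
    ; op-cong  = λ f p i → Algebra.op-cong (C i) f (λ j → p j i)
    ; nonempty = λ i → Algebra.nonempty (C i)
    }
    where
    Carrierᵖ : Set ℓ
    Carrierᵖ = ∀ i → Carrier (C i)

  record Subuniverse (C : Algebra τ) : Set (suc ℓ) where
    open Algebra C using (_≈_)
    field
      pred     : Pred (Carrier C) ℓ
      resp     : ∀ {x y} → x ≈ y → x ∈ pred → y ∈ pred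
      closed   : ∀ f (x : Vector (Carrier C) (ar τ f)) →
                 (∀ i → x i ∈ pred) → op C f x ∈ pred
      nonempty : ∃ λ x → x ∈ pred

  subalgebra : (C : Algebra τ) → Subuniverse C → Algebra τ
  subalgebra C S = record
    { domain   = record
      { Carrier       = Σ (Carrier C) pred
      ; _≈_           = λ x y → proj₁ x C.≈ proj₁ y
      ; isEquivalence = record
        { refl = C.refl ; sym = C.sym ; trans = C.trans }
      }
    ; op       = λ f x → op C f (λ i → proj₁ (x i))
                       , closed f (λ i → proj₁ (x i)) (λ i → proj₂ (x i))
    ; op-cong  = λ f p → C.op-cong f p
    ; nonempty = nonempty
    }
    where
    module C = Algebra C
    open Subuniverse S

  record IsHomomorphism (C D : Algebra τ) (h : Carrier C → Carrier D) : Set ℓ where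
    private
      module C = Algebra C
      module D = Algebra D
    field
      cong : Congruent C._≈_ D._≈_ h
      homo : ∀ f (x : Vector (Carrier C) (ar τ f)) →
             h (op C f x) D.≈ op D f (λ i → h (x i))

  record HomomorphicImage (C D : Algebra τ) : Set ℓ where
    field
      hom            : Carrier C → Carrier D
      isHomomorphism : IsHomomorphism C D hom
      surjective     : Surjective (Algebra._≈_ C) (Algebra._≈_ D) hom

  -- The pseudovariety generated by A.  Finite products include the empty
  -- one; closure under isomorphic copies is a case of `image`.

  data Pseudovariety (A : Algebra τ) : Pred (Algebra τ) (suc ℓ) where
    base    : A ∈ Pseudovariety A
    product : ∀ {n} (C : Fin n → Algebra τ) →
              (∀ i → C i ∈ Pseudovariety A) → ∏ C ∈ Pseudovariety A
    sub     : ∀ {C} (S : Subuniverse C) →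
              C ∈ Pseudovariety A → subalgebra C S ∈ Pseudovariety A
    image   : ∀ {C D} → HomomorphicImage C D →
              C ∈ Pseudovariety A → D ∈ Pseudovariety A

  -- Membership in the least subset that contains all g i and is closed
  -- under the operations.

  data Generated (A : Algebra τ) {n} (g : Vector (Carrier A) n) :
                 Pred (Carrier A) ℓ where
    gen  : ∀ i → g i ∈ Generated A g
    app  : ∀ f (x : Vector (Carrier A) (ar τ f)) →
           (∀ i → x i ∈ Generated A g) → op A f x ∈ Generated A g
    resp : ∀ {x y} → Algebra._≈_ A x y →
           x ∈ Generated A g → y ∈ Generated A g

  FinitelyGenerated : Algebra τ → Set ℓ
  FinitelyGenerated A =
    ∃ λ n → Σ (Vector (Carrier A) n) λ g → ∀ a → a ∈ Generated A g

data Term {ℓ} (τ : Signature ℓ) (k : ℕ) : Set ℓ where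
  var : Fin k → Term τ k
  app : (f : Op τ) → Vector (Term τ k) (ar τ f) → Term τ k

module _ {ℓ} {τ : Signature ℓ} where

  open Algebra using (Carrier; op)

  ⟦_⟧ : ∀ {k} → Term τ k → (A : Algebra τ) → Vector (Carrier A) k → Carrier A
  ⟦ var i   ⟧ A a = a i
  ⟦ app f t ⟧ A a = op A f (λ i → ⟦ t i ⟧ A a)

  EqualOn : (A : Algebra τ) (k : ℕ) → Rel (Vector (Carrier A) k → Carrier A) ℓ
  EqualOn A k f g = ∀ a → Algebra._≈_ A (f a) (g a)

  record TermOperation (A : Algebra τ) (k : ℕ) : Set ℓ where
    field
      fun     : Vector (Carrier A) k → Carrier A
      term    : Term τ k
      induced : EqualOn A k fun (⟦ term ⟧ A)

  open TermOperation public

  -- The k-ary part of the term clone: equality compares the operations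
  -- only, not the terms inducing them.

  Clo : Algebra τ → ℕ → Setoid ℓ ℓ
  Clo A k = record
    { Carrier       = TermOperation A k
    ; _≈_           = λ f g → EqualOn A k (fun f) (fun g)
    ; isEquivalence = record
      { refl  = λ a → A.refl
      ; sym   = λ p a → A.sym (p a)
      ; trans = λ p q a → A.trans (p a) (q a)
      }
    }
    where module A = Algebra A

  CloneMap : Algebra τ → Algebra τ → Set ℓ
  CloneMap A B = ∀ k → .{{NonZero k}} → Func (Clo A k) (Clo B k)

  NaturalMapWellDefined : Algebra τ → Algebra τ → Set ℓ
  NaturalMapWellDefined A B =
    ∀ k → .{{NonZero k}} → (s t : Term τ k) →
    EqualOn A k (⟦ s ⟧ A) (⟦ t ⟧ A) → EqualOn B k (⟦ s ⟧ B) (⟦ t ⟧ B)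

  naturalMap : (A B : Algebra τ) → NaturalMapWellDefined A B → CloneMap A B
  naturalMap A B wd k = record
    { to   = λ f → record
      { fun     = ⟦ term f ⟧ B
      ; term    = term f
      ; induced = λ b → Algebra.refl B
      }
    ; cong = λ {f} {g} f≈g → wd k (term f) (term g) λ a →
        A.trans (A.sym (induced f a)) (A.trans (f≈g a) (induced g a))
    }
    where module A = Algebra A

  AgreeAt : (A : Algebra τ) (k : ℕ) → Vector (Carrier A) k →
            Rel (TermOperation A k) ℓ
  AgreeAt A k a f g = Algebra._≈_ A (fun f a) (fun g a)

  -- Members of the filter generated by the sets AgreeAt a: the (setoid-)
  -- subsets U that contain the intersection of finitely many of them.

  IsEntourage : (A : Algebra τ) (k : ℕ) → Rel (TermOperation A k) ℓ → Set ℓ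
  IsEntourage A k U =
    (U Respects₂ Setoid._≈_ (Clo A k)) ×
    Σ (List (Vector (Carrier A) k)) λ as →
      ∀ f g → All (λ a → AgreeAt A k a f g) as → U f g

  UniformlyContinuous : (A B : Algebra τ) → CloneMap A B → Set (suc ℓ)
  UniformlyContinuous A B ξ =
    ∀ k → .{{_ : NonZero k}} → (U : Rel (TermOperation B k) ℓ) →
    IsEntourage B k U →
    IsEntourage A k (λ f g → U (Func.to (ξ k) f) (Func.to (ξ k) g))

{-# OPTIONS --safe #-}
module Submission where

-- Both directions rest on one relation between points: a finite list as of
-- k-tuples of A determines a k-tuple c of an algebra C if any two k-ary
-- terms that agree in A at every tuple of as agree in C at c.  Uniform
-- continuity of the natural mapping from Clo A to Clo B says that every
-- nonempty tuple of B is determined by some finite list of tuples of A.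
--
-- If B lies in the pseudovariety generated by A, such a list is found by
-- induction on the derivation (`determining`): a tuple of A is determined by
-- itself, a tuple of a product by the concatenation of lists for its
-- components, a tuple of a subalgebra by a list for the same tuple in the
-- ambient algebra, and a tuple of a homomorphic image by a list for any
-- tuple of preimages.  Well-definedness is an immediate consequence.
--
-- Conversely, let the tuple b generate B and be determined by the m tuples
-- in as.  Read as an m-by-k matrix, as has k columns in the power of A with
-- exponent m.  Sending the value of a term at the columns to its value at b
-- is well defined exactly because as determines b, and it is a homomorphism
-- from the subalgebra generated by the columns onto B (`termSpan-image`).

open import Level using (Level)
open import Data.Fin using (Fin; zero; suc)
open import Data.List using (List; []; _∷_; [_]; length; lookup; concat; map; tabulate)
open import Data.List.Relation.Unary.All as All using (All; []; _∷_)
import Data.List.Relation.Unary.All.Properties as All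
open import Data.Nat using (suc; NonZero)
open import Data.Product using (Σ; ∃; _,_; proj₁; proj₂)
import Data.Vec.Functional as Vector
open Vector using (Vector)
open import Function.Bundles using (_⇔_; mk⇔; Func)
open import Relation.Unary using (Pred; _∈_)
open import Defs

module _ {ℓ : Level} {τ : Signature ℓ} where

  open Algebra using (Carrier)

  -- Evaluation of terms

  homo-term : ∀ {C D : Algebra τ} {h : Carrier C → Carrier D} →
              IsHomomorphism C D h → ∀ {k} (t : Term τ k) c →
              Algebra._≈_ D (h (⟦ t ⟧ C c)) (⟦ t ⟧ D (λ i → h (c i)))
  homo-term {D = D} H (var i)   c = Algebra.refl D
  homo-term {D = D} H (app f t) c =
    D.trans (IsHomomorphism.homo H f _) (D.op-cong f λ i → homo-term H (t i) c)
    where module D = Algebra D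

  term-cong : ∀ (C : Algebra τ) {k} (t : Term τ k) {c d : Vector (Carrier C) k} →
              (∀ i → Algebra._≈_ C (c i) (d i)) →
              Algebra._≈_ C (⟦ t ⟧ C c) (⟦ t ⟧ C d)
  term-cong C (var i)   p = p i
  term-cong C (app f t) p = Algebra.op-cong C f λ i → term-cong C (t i) p

  projection-isHomomorphism : ∀ {n} (C : Fin n → Algebra τ) i →
                              IsHomomorphism (∏ C) (C i) (λ x → x i)
  projection-isHomomorphism C i = record
    { cong = λ p → p i
    ; homo = λ f x → Algebra.refl (C i)
    }

  inclusion-isHomomorphism : ∀ {C : Algebra τ} (S : Subuniverse C) →
                             IsHomomorphism (subalgebra C S) C proj₁
  inclusion-isHomomorphism {C} S = record
    { cong = λ p → p
    ; homo = λ f x → Algebra.refl C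
    }

  -- The operation induced by t, with t as the inducing term.
  termOperation : ∀ (A : Algebra τ) {k} → Term τ k → TermOperation A k
  termOperation A t = record
    { fun     = ⟦ t ⟧ A
    ; term    = t
    ; induced = λ a → Algebra.refl A
    }

  -- The tuples at which the equation s = t holds in A.
  TermsAgreeAt : ∀ (A : Algebra τ) {k} (s t : Term τ k) →
                 Pred (Vector (Carrier A) k) ℓ
  TermsAgreeAt A s t a = Algebra._≈_ A (⟦ s ⟧ A a) (⟦ t ⟧ A a)

  -- An equation between terms transfers along a homomorphism from a tuple
  -- to its image.
  homo-agree : ∀ {C D : Algebra τ} {h : Carrier C → Carrier D} →
               IsHomomorphism C D h → ∀ {k} (s t : Term τ k) {c} →
               TermsAgreeAt C s t c → TermsAgreeAt D s t (λ i → h (c i))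
  homo-agree {D = D} H s t {c} p =
    D.trans (D.sym (homo-term H s c))
            (D.trans (IsHomomorphism.cong H p) (homo-term H t c))
    where module D = Algebra D

  -- Finite lists of tuples determining a tuple

  -- The list `as` of tuples of A determines the tuple c of C: every equation
  -- between k-ary terms that holds in A at all members of `as` holds in C
  -- at c.
  Determines : ∀ (A C : Algebra τ) {k} → List (Vector (Carrier A) k) →
               Vector (Carrier C) k → Set ℓ
  Determines A C {k} as c =
    ∀ (s t : Term τ k) → All (TermsAgreeAt A s t) as → TermsAgreeAt C s t c

  determining : ∀ {A C : Algebra τ} → C ∈ Pseudovariety A →
                ∀ {k} (c : Vector (Carrier C) k) →
                ∃ λ as → Determines A C as c
  determining base c = [ c ] , λ s t → All.head
  determining {A} (product C C∈) c =
      concat (tabulate λ i → proj₁ (ih i))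
    , λ s t p i →
        let module Cᵢ = Algebra (C i)
            π = projection-isHomomorphism C i
        in  Cᵢ.trans (homo-term π s c)
              (Cᵢ.trans (proj₂ (ih i) s t (All.tabulate⁻ (All.concat⁻ p) i))
                        (Cᵢ.sym (homo-term π t c)))
    where
    ih : ∀ i → ∃ λ as → Determines A (C i) as (λ j → c j i)
    ih i = determining (C∈ i) (λ j → c j i)
  determining {A} (sub {C} S C∈) c =
      proj₁ ih
    , λ s t p → C.trans (homo-term ι s c)
                  (C.trans (proj₂ ih s t p) (C.sym (homo-term ι t c)))
    where
    module C = Algebra C
    ι = inclusion-isHomomorphism S
    ih : ∃ λ as → Determines A C as (λ j → proj₁ (c j))
    ih = determining C∈ (λ j → proj₁ (c j))
  determining {A} (image {C} {D} I C∈) d =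
      proj₁ ih
    , λ s t p → D.trans (term-cong D s λ j → D.sym (h-pre j))
                  (D.trans (homo-agree isHomomorphism s t (proj₂ ih s t p))
                           (term-cong D t h-pre))
    where
    module D = Algebra D
    open HomomorphicImage I
    pre : Vector (Carrier C) _
    pre j = proj₁ (surjective (d j))
    h-pre : ∀ j → hom (pre j) D.≈ d j
    h-pre j = proj₂ (surjective (d j)) (Algebra.refl C)
    ih : ∃ λ as → Determines A C as pre
    ih = determining C∈ pre

  -- From the pseudovariety to uniform continuity

  pseudovariety⇒wellDefined : ∀ {A B : Algebra τ} → B ∈ Pseudovariety A →
                              NaturalMapWellDefined A B
  pseudovariety⇒wellDefined B∈ k s t p b =
    proj₂ (determining B∈ b) s t (All.universal p _)

  pseudovariety⇒uniformlyContinuous :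
    ∀ {A B : Algebra τ} → B ∈ Pseudovariety A →
    (wd : NaturalMapWellDefined A B) →
    UniformlyContinuous A B (naturalMap A B wd)
  pseudovariety⇒uniformlyContinuous {A} {B} B∈ wd k U ((respʳ , respˡ) , bs , bs⊆U) =
      ( (λ {f} {g} {h} p → respʳ (Func.cong ν {g} {h} p))
      , (λ {f} {g} {h} p → respˡ (Func.cong ν {g} {h} p)) )
    , concat (map list bs)
    , λ f g p → bs⊆U _ _
        (All.map (λ {b} q → proj₂ (determining B∈ b) (term f) (term g)
                              (All.map (terms-agree f g) q))
                 (All.map⁻ (All.concat⁻ p)))
    where
    module A = Algebra A
    ν : Func (Clo A k) (Clo B k)
    ν = naturalMap A B wd k
    list : Vector (Carrier B) k → List (Vector (Carrier A) k)
    list b = proj₁ (determining B∈ b)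
    terms-agree : ∀ f g {a} → AgreeAt A k a f g →
                  TermsAgreeAt A (term f) (term g) a
    terms-agree f g {a} p =
      A.trans (A.sym (induced f a)) (A.trans p (induced g a))

  -- From uniform continuity to the pseudovariety

  -- Uniform continuity at the basic entourage given by b.
  uniformlyContinuous⇒determining :
    ∀ {A B : Algebra τ} (wd : NaturalMapWellDefined A B) →
    UniformlyContinuous A B (naturalMap A B wd) →
    ∀ {k} .{{_ : NonZero k}} (b : Vector (Carrier B) k) →
    ∃ λ as → Determines A B as b
  uniformlyContinuous⇒determining {A} {B} wd uc {k} b =
    let (_ , as , H) = uc k (AgreeAt B k b) entourage
    in  as , λ s t → H (termOperation A s) (termOperation A t)
    where
    module B = Algebra B
    entourage : IsEntourage B k (AgreeAt B k b)
    entourage = ( (λ p q → B.trans q (p b))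
                , (λ p q → B.trans (B.sym (p b)) q) )
              , [ b ] , λ f g → All.head

  -- The subalgebra generated by the tuple c, as the set of values of terms
  -- at c.  A member carries a term inducing it; equality ignores the term.
  -- At least one generator is needed for nonemptiness.
  termSpan : ∀ (C : Algebra τ) {n} → Vector (Carrier C) (suc n) → Subuniverse C
  termSpan C {n} c = record
    { pred     = λ x → Σ (Term τ (suc n)) λ t → x C.≈ ⟦ t ⟧ C c
    ; resp     = λ x≈y (t , p) → t , C.trans (C.sym x≈y) p
    ; closed   = λ f x p → app f (λ i → proj₁ (p i))
                         , C.op-cong f (λ i → proj₂ (p i))
    ; nonempty = c zero , var zero , C.refl
    }
    where module C = Algebra C

  termSpan-image :
    ∀ {C D : Algebra τ} {n} {c : Vector (Carrier C) (suc n)}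
      {d : Vector (Carrier D) (suc n)} →
    (∀ s t → TermsAgreeAt C s t c → TermsAgreeAt D s t d) →
    (∀ y → ∃ λ t → Algebra._≈_ D (⟦ t ⟧ D d) y) →
    HomomorphicImage (subalgebra C (termSpan C c)) D
  termSpan-image {C} {D} {d = d} transfer values = record
    { hom            = eval
    ; isHomomorphism = record
      { cong = λ {x} {y} → eval-cong {x} {y}
      ; homo = λ f x → D.refl
      }
    ; surjective     = λ y →
        let (t , t≈y) = values y
            x         = _ , t , C.refl
        in  x , λ {z} z≈x → D.trans (eval-cong {z} {x} z≈x) t≈y
    }
    where
    module C = Algebra C
    module D = Algebra D
    module S = Algebra (subalgebra C (termSpan C _))
    eval : S.Carrier → D.Carrier
    eval (_ , t , _) = ⟦ t ⟧ D d
    eval-cong : ∀ {x y} → x S.≈ y → eval x D.≈ eval y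
    eval-cong {_ , s , x≈s} {_ , t , y≈t} x≈y =
      transfer s t (C.trans (C.sym x≈s) (C.trans x≈y y≈t))

  -- Lists of tuples are turned into matrices whose rows are the tuples; the
  -- columns are tuples of elements of a power of A.
  columns : ∀ (A : Algebra τ) {k} (as : List (Vector (Carrier A) k)) →
            Vector (Carrier (∏ {n = length as} (λ _ → A))) k
  columns A as j i = lookup as i j

  all-lookup : ∀ {a p} {X : Set a} {P : Pred X p} (xs : List X) →
               (∀ i → P (lookup xs i)) → All P xs
  all-lookup []       p = []
  all-lookup (x ∷ xs) p = p zero ∷ all-lookup xs (λ i → p (suc i))

  columns-agree : ∀ (A : Algebra τ) {k} (as : List (Vector (Carrier A) k))
                  (s t : Term τ k) →
                  TermsAgreeAt (∏ (λ _ → A)) s t (columns A as) →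
                  All (TermsAgreeAt A s t) as
  columns-agree A as s t p =
    all-lookup as λ i →
      homo-agree (projection-isHomomorphism (λ _ → A) i) s t p

  determined⇒pseudovariety :
    ∀ {A B : Algebra τ} {n} {as} {b : Vector (Carrier B) (suc n)} →
    Determines A B as b →
    (∀ y → ∃ λ t → Algebra._≈_ B (⟦ t ⟧ B b) y) →
    B ∈ Pseudovariety A
  determined⇒pseudovariety {A} {as = as} det values =
    image (termSpan-image (λ s t p → det s t (columns-agree A as s t p)) values)
      (sub (termSpan _ (columns A as)) (product (λ _ → A) λ _ → base))

  -- The element x put in front of the generators makes the tuple nonempty,
  -- as needed when the algebra is generated by its constants.
  generated⇒value : ∀ (B : Algebra τ) {n} (x : Carrier B)
                    {g : Vector (Carrier B) n} {y} → y ∈ Generated B g →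
                    ∃ λ t → Algebra._≈_ B (⟦ t ⟧ B (x Vector.∷ g)) y
  generated⇒value B x (gen i) = var (suc i) , Algebra.refl B
  generated⇒value B x (app f y y∈) =
      app f (λ i → proj₁ (generated⇒value B x (y∈ i)))
    , Algebra.op-cong B f (λ i → proj₂ (generated⇒value B x (y∈ i)))
  generated⇒value B x (resp y≈z y∈) =
    let (t , p) = generated⇒value B x y∈ in t , Algebra.trans B p y≈z

  uniformlyContinuous⇒pseudovariety :
    ∀ {A B : Algebra τ} → FinitelyGenerated B →
    (wd : NaturalMapWellDefined A B) →
    UniformlyContinuous A B (naturalMap A B wd) →
    B ∈ Pseudovariety A
  uniformlyContinuous⇒pseudovariety {A} {B} (n , g , g-generates) wd uc =
    determined⇒pseudovariety
      (proj₂ (uniformlyContinuous⇒determining wd uc (b₀ Vector.∷ g)))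
      (λ y → generated⇒value B b₀ (g-generates y))
    where b₀ = Algebra.nonempty B

corollary5p2 : ∀ {ℓ : Level} (τ : Signature ℓ) (A B : Algebra τ) →
    FinitelyGenerated A → FinitelyGenerated B →
    (B ∈ Pseudovariety A) ⇔
    Σ (NaturalMapWellDefined A B) λ wd →
    UniformlyContinuous A B (naturalMap A B wd)
corollary5p2 τ A B _ fgB = mk⇔
  (λ B∈ → let wd = pseudovariety⇒wellDefined B∈
          in  wd , pseudovariety⇒uniformlyContinuous B∈ wd)
  (λ (wd , uc) → uniformlyContinuous⇒pseudovariety fgB wd uc)
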